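{- For every integer $t \ge 3$ and every $\nu \in [0,1]$, \[ \Phi_t(\nu) = \begin{cases} \frac{t-1}{t}\,\Phi_t(t\nu) & \text{if } \nu < 1/t,\\[2pt] \frac{t-1}{t} + \frac{1}{t}\,\Phi_t\!\left(\frac{t\nu - 1}{t-1}\right) & \text{if } \nu \ge 1/t. \end{cases} \]
   Context: $K_t^n$ is the graph with vertex set $[t]^n = \{1,\dots,t\}^n$ in which $x,y$ are adjacent iff $x_i \neq y_i$ for all $i \in [n]$. For $S \subseteq [t]^n$, $\mu(S) := |S|/t^n$ and $\partial S := \{x \in [t]^n : \exists y \in S \text{ adjacent to } x\}$ (the vertex boundary, possibly containing points of $S$). For $\nu\in[0,1]$, $\Phi(K_t^n,\nu) := \inf\{\mu(\partial S) : S \subseteq [t]^n,\ \mu(S) \ge \nu\}$ and $\Phi_t(\nu) := \inf_{n \ge 1} \Phi(K_t^n, \nu)$. -}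

module Defs where

open import Data.Nat as ℕ using (ℕ; zero; suc; _^_; _∸_; NonZero)
open import Data.Nat.Properties using (m^n≢0)
open import Data.Integer using (+_)
open import Data.Rational using (ℚ; _/_; _≤_; _<_; _+_; _*_; 0ℚ)
open import Data.Fin using (Fin)
open import Data.Fin.Properties using (all?) renaming (_≟_ to _≟ᶠ_)
open import Data.Vec using (Vec; []; _∷_; lookup)
open import Data.List using (List; []; _∷_; map; concatMap; length; filterᵇ)
open import Data.Bool.ListAction using (any)
open import Data.List as L using (allFin)
open import Data.Bool using (Bool; _∧_)
open import Data.Product using (∃; _×_)
open import Relation.Nullary using (¬_; does)
open import Relation.Nullary.Decidable using (¬?)

-- Real numbers (only what is needed): a real ν is represented by the
-- predicate  q ↦ (ν ≤ q)  on ℚ, i.e. a closed upper Dedekind ray.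
record ℝ : Set₁ where
  field
    Up        : ℚ → Set                       -- Up q  means  ν ≤ q
    up-closed : ∀ {p q} → p ≤ q → Up p → Up q
    inhabited : ∃ Up
    bounded   : ∃ λ q → ¬ Up q
    closed    : ∀ q → (∀ r → q < r → Up r) → Up q
open ℝ public

_≤ʳ_ : ℝ → ℚ → Set
ν ≤ʳ q = Up ν q

_<ʳ_ : ℚ → ℝ → Set
q <ʳ ν = ¬ (ν ≤ʳ q)

InUnit : ℝ → Set
InUnit ν = (∀ q → q < 0ℚ → q <ʳ ν) × (ν ≤ʳ (+ 1 / 1))

_ʳ<_ : ℝ → ℚ → Set
ν ʳ< q = ∃ λ r → (r < q) × (ν ≤ʳ r)

Vertex : ℕ → ℕ → Set
Vertex t n = Vec (Fin t) n

Adjacent : ∀ {t n} → Vertex t n → Vertex t n → Set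
Adjacent {n = n} x y = ∀ (i : Fin n) → ¬ (lookup x i Relation.Binary.PropositionalEquality.≡ lookup y i)
  where import Relation.Binary.PropositionalEquality

adjacent? : ∀ {t n} (x y : Vertex t n) → Bool
adjacent? x y = does (all? (λ i → ¬? (lookup x i ≟ᶠ lookup y i)))

allVertices : ∀ t n → List (Vertex t n)
allVertices t zero    = [] ∷ []
allVertices t (suc n) = concatMap (λ a → map (a ∷_) (allVertices t n)) (allFin t)

Subset : ℕ → ℕ → Set
Subset t n = Vertex t n → Bool

card : ∀ {t n} → Subset t n → ℕ
card {t} {n} S = length (filterᵇ S (allVertices t n))

μ : ∀ {t n} .{{_ : NonZero t}} → Subset t n → ℚ
μ {t} {n} S = (+ card S) / (t ^ n)
  where instance _ = m^n≢0 t n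

∂ : ∀ {t n} → Subset t n → Subset t n
∂ {t} {n} S x = any (λ y → S y ∧ adjacent? x y) (allVertices t n)

-- Φ_t(ν) = inf_{n ≥ 1} inf { μ(∂S) : S ⊆ [t]^n, μ(S) ≥ ν }.
-- Since ℝ is not available as a type, statements about Φ_t are made
-- through its rational lower bounds: for an increasing affine map
-- f(x) = a + b x (b > 0),
--   q ≤ f(Φ_t(ν))  iff  ∀ n ≥ 1, ∀ S, μ(S) ≥ ν → q ≤ f(μ(∂S)).
-- `Cond` is the predicate  r ↦ (ν ≤ r)  describing the real ν.
BelowΦ : (t : ℕ) .{{_ : NonZero t}} → (Cond : ℚ → Set) → (f : ℚ → ℚ) → ℚ → Set
BelowΦ t Cond f q =
  ∀ (n : ℕ) (S : Subset t (suc n)) → Cond (μ S) → q ≤ f (μ (∂ S))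

{-# OPTIONS --safe #-}
-- For S ⊆ [t]^(n+1), let P be the set of fibres (along the first coordinate) that S meets and Q the set
-- of fibres that it meets at least twice.  Then |S| ≤ |P| + (t−1)|Q| and |∂S| ≥ (t−1)|∂P| + |∂Q|.
-- Induction on n therefore shows that every set is dominated (at least as large, with no larger boundary)
-- by a lexicographic segment, provided that two nested segments a ⊑ b of dimension n can be merged into
-- one segment of dimension n+1.  That two-point inequality reduces to the subadditivity of the boundary
-- of a segment as a function of its size, where sizes exceeding t^n carry.
-- A segment of dimension n+1 is either {0}×s or ({0}×[t]^n) ∪ ({1,…,t−1}×s) for a segment s of
-- dimension n, and these two shapes are the two cases of the recursion.
module Submission where

open import Defs
open import Data.Nat using (ℕ; _≤_; _∸_; NonZero)
open import Data.Nat as ℕ using (zero; suc; _^_; z≤n; s≤s)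
open import Data.Nat.Properties as ℕₚ using (≤-refl; ≤-trans; module ≤-Reasoning; +-0-commutativeMonoid; +-*-semiring)
open import Data.Nat.Tactic.RingSolver using (solve-∀)
open import Data.Bool using (Bool; true; false; T; T?; if_then_else_; _∧_)
open import Data.Bool.Properties using (T-∧)
open import Data.Empty using (⊥-elim)
open import Data.Fin using (Fin; zero; suc)
open import Data.Fin.Properties using (all?; any?; suc-injective; 0≢1+n) renaming (_≟_ to _≟ᶠ_)
open import Data.List using (List; []; _∷_; map; concatMap; length; filterᵇ; tabulate)
open import Data.List.Properties using (filter-++; length-++)
open import Data.List.Membership.Propositional using (_∈_; find; lose)
open import Data.List.Membership.Propositional.Properties using (∈-map⁺; ∈-concat⁺′; ∈-allFin)
open import Data.List.Relation.Unary.Any using (here)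
open import Data.List.Relation.Unary.Any.Properties using (any⁺; any⁻)
open import Data.Product using (_×_; _,_; ∃; proj₁; proj₂)
open import Data.Sum using (_⊎_; inj₁; inj₂)
open import Data.Vec using ([]; _∷_; lookup)
open import Function using (case_of_)
open import Function.Bundles using (_⇔_; mk⇔; Equivalence)
open import Relation.Binary.PropositionalEquality using (_≡_; _≢_; refl; sym; trans; cong; cong₂; subst; subst₂; module ≡-Reasoning)
open import Relation.Nullary using (¬_; Dec; yes; no; does)
open import Relation.Nullary.Decidable using (¬?; _×-dec_; decidable-stable)

-- Lexicographic segments

module Segments (r : ℕ) where
  open import Data.Nat using (_+_; _*_)

  u t : ℕ
  u = suc r
  t = suc u

  -- low s stands for {0}×s and high s for ({0}×[t]^n) ∪ ({1,…,u}×s); size and bdry are the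
  -- cardinalities of the set and of its boundary.
  data Seg : ℕ → Set where
    none all : Seg 0
    low high : ∀ {n} → Seg n → Seg (suc n)

  size : ∀ {n} → Seg n → ℕ
  size none = 0
  size all = 1
  size (low s) = size s
  size {suc n} (high s) = t ^ n + u * size s

  bdry : ∀ {n} → Seg n → ℕ
  bdry none = 0
  bdry all = 1
  bdry (low s) = u * bdry s
  bdry {suc n} (high s) = u * t ^ n + bdry s

  size≤ : ∀ {n} (s : Seg n) → size s ≤ t ^ n
  size≤ none = z≤n
  size≤ all = ≤-refl
  size≤ {suc n} (low s) = ≤-trans (size≤ s) (ℕₚ.m≤m+n _ _)
  size≤ {suc n} (high s) = ℕₚ.+-monoʳ-≤ (t ^ n) (ℕₚ.*-monoʳ-≤ u (size≤ s))

  bdry≤ : ∀ {n} (s : Seg n) → bdry s ≤ t ^ n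
  bdry≤ none = z≤n
  bdry≤ all = ≤-refl
  bdry≤ {suc n} (low s) = ≤-trans (ℕₚ.*-monoʳ-≤ u (bdry≤ s)) (ℕₚ.m≤n+m _ (t ^ n))
  bdry≤ {suc n} (high s) = ≤-trans (ℕₚ.+-monoʳ-≤ (u * t ^ n) (bdry≤ s)) (ℕₚ.≤-reflexive (ℕₚ.+-comm (u * t ^ n) (t ^ n)))

  -- A full segment cannot start with `low`, since size at most t^n is less than t^(n+1), and after
  -- `high` the rest must again be full. Serves the case in which `low s` is the whole layer
  -- {0}×[t]^n.
  size-full⇒bdry-full : ∀ {n} (s : Seg n) → t ^ n ≤ size s → t ^ n ≤ bdry s
  size-full⇒bdry-full none ()
  size-full⇒bdry-full all le = ≤-refl
  size-full⇒bdry-full {suc n} (low s) le = ⊥-elim (ℕₚ.<⇒≱ (ℕₚ.m<m+n (t ^ n) (ℕₚ.≤-trans (ℕₚ.m^n>0 t n) (ℕₚ.m≤m+n (t ^ n) _))) (≤-trans le (size≤ s)))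
  size-full⇒bdry-full {suc n} (high s) le = begin
    t ^ n + u * t ^ n   ≡⟨ ℕₚ.+-comm (t ^ n) _ ⟩
    u * t ^ n + t ^ n   ≤⟨ ℕₚ.+-monoʳ-≤ (u * t ^ n) (size-full⇒bdry-full s (ℕₚ.*-cancelˡ-≤ u (ℕₚ.+-cancelˡ-≤ (t ^ n) _ _ le))) ⟩
    u * t ^ n + bdry s  ∎
    where open ≤-Reasoning

  -- Implies inclusion of the sets. `low⊑high` asks nothing of `a` and `b`, because `low a` lies in
  -- the layer {0}×[t]^n and `high b` contains it. That layer has two codes, a full segment under
  -- `low` and an empty one under `high`; the order puts the first below the second.
  data _⊑_ : ∀ {n} → Seg n → Seg n → Set where
    none⊑ : ∀ {s} → none ⊑ s
    all⊑all : all ⊑ all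
    low⊑low : ∀ {n} {a b : Seg n} → a ⊑ b → low a ⊑ low b
    low⊑high : ∀ {n} {a b : Seg n} → low a ⊑ high b
    high⊑high : ∀ {n} {a b : Seg n} → a ⊑ b → high a ⊑ high b

  ⊑-refl : ∀ {n} {s : Seg n} → s ⊑ s
  ⊑-refl {s = none} = none⊑
  ⊑-refl {s = all} = all⊑all
  ⊑-refl {s = low s} = low⊑low ⊑-refl
  ⊑-refl {s = high s} = high⊑high ⊑-refl

  ⊑-total : ∀ {n} (a b : Seg n) → a ⊑ b ⊎ b ⊑ a
  ⊑-total none b = inj₁ none⊑
  ⊑-total all none = inj₂ none⊑
  ⊑-total all all = inj₁ all⊑all
  ⊑-total (low a) (low b) = Data.Sum.map low⊑low low⊑low (⊑-total a b)
  ⊑-total (low a) (high b) = inj₁ low⊑high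
  ⊑-total (high a) (low b) = inj₂ low⊑high
  ⊑-total (high a) (high b) = Data.Sum.map high⊑high high⊑high (⊑-total a b)

  bdry-mono : ∀ {n} {a b : Seg n} → a ⊑ b → bdry a ≤ bdry b
  bdry-mono none⊑ = z≤n
  bdry-mono all⊑all = ≤-refl
  bdry-mono (low⊑low le) = ℕₚ.*-monoʳ-≤ u (bdry-mono le)
  bdry-mono (low⊑high {a = a}) = ≤-trans (ℕₚ.*-monoʳ-≤ u (bdry≤ a)) (ℕₚ.m≤m+n _ _)
  bdry-mono {suc n} (high⊑high le) = ℕₚ.+-monoʳ-≤ (u * t ^ n) (bdry-mono le)

  -- The second alternative is the carry, a + b = t^n + c.
  Addition : ∀ {n} → Seg n → Seg n → Set
  Addition {n} a b = ∃ λ (c : Seg n) →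
      (size a + size b ≤ size c × bdry c ≤ bdry a + bdry b)
    ⊎ (size a + size b ≤ t ^ n + size c × t ^ n + bdry c ≤ bdry a + bdry b)

  Addition-sym : ∀ {n} (a b : Seg n) → Addition a b → Addition b a
  Addition-sym a b s rewrite ℕₚ.+-comm (size a) (size b) | ℕₚ.+-comm (bdry a) (bdry b) = s

  -- A carry t^n + c of dimension n still fits into dimension n+1: t^n fills layer 0, and c is
  -- enlarged to `u` copies of itself, both in size and in boundary.
  low+low : ∀ {n} (a b : Seg n) → Addition a b → Addition (low a) (low b)
  low+low {n} a b (c , inj₁ (p , q)) = low c , inj₁ (p , ≤-trans (ℕₚ.*-monoʳ-≤ u q) (ℕₚ.≤-reflexive (ℕₚ.*-distribˡ-+ u (bdry a) _)))
  low+low {n} a b (c , inj₂ (p , q)) = high c , inj₁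
    ( ≤-trans p (ℕₚ.+-monoʳ-≤ (t ^ n) (ℕₚ.m≤m+n _ _))
    , (begin
        u * t ^ n + bdry c         ≤⟨ ℕₚ.+-monoʳ-≤ (u * t ^ n) (ℕₚ.m≤m+n _ _) ⟩
        u * t ^ n + u * bdry c     ≡⟨ ℕₚ.*-distribˡ-+ u (t ^ n) _ ⟨
        u * (t ^ n + bdry c)       ≤⟨ ℕₚ.*-monoʳ-≤ u q ⟩
        u * (bdry a + bdry b)      ≡⟨ ℕₚ.*-distribˡ-+ u (bdry a) _ ⟩
        u * bdry a + u * bdry b    ∎))
    where open ≤-Reasoning

  -- Without a carry, x is enlarged to u·x, which turns the size into N + u(x + y), and X is
  -- enlarged likewise. With a carry, one of the `u` copies of y joins x and the other `r` are
  -- bounded by N each, which leaves t^(n+1) + z.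
  low+high : ∀ {n} (a b : Seg n) → Addition a b → Addition (low a) (high b)
  low+high {n} a b (c , inj₁ (p , q)) = high c , inj₁
    ( (begin
        x + (N + u * y)            ≤⟨ ℕₚ.+-monoˡ-≤ _ (ℕₚ.m≤m+n x (r * x)) ⟩
        u * x + (N + u * y)        ≡⟨ e₁ u N x y ⟩
        N + u * (x + y)            ≤⟨ ℕₚ.+-monoʳ-≤ N (ℕₚ.*-monoʳ-≤ u p) ⟩
        N + u * size c             ∎)
    , (begin
        u * N + bdry c             ≤⟨ ℕₚ.+-monoʳ-≤ (u * N) q ⟩
        u * N + (X + Y)            ≡⟨ e₂ u N X Y ⟩
        X + (u * N + Y)            ≤⟨ ℕₚ.+-monoˡ-≤ _ (ℕₚ.m≤m+n X (r * X)) ⟩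
        u * X + (u * N + Y)        ∎))
    where
    open ≤-Reasoning
    N = t ^ n
    x = size a
    y = size b
    X = bdry a
    Y = bdry b
    e₁ : ∀ u N x y → u * x + (N + u * y) ≡ N + u * (x + y)
    e₁ = solve-∀
    e₂ : ∀ u N X Y → u * N + (X + Y) ≡ X + (u * N + Y)
    e₂ = solve-∀
  low+high {n} a b (c , inj₂ (p , q)) = low c , inj₂
    ( (begin
        x + (N + u * y)            ≡⟨ e₁ r N x y ⟩
        N + r * y + (x + y)        ≤⟨ ℕₚ.+-mono-≤ (ℕₚ.+-monoʳ-≤ N (ℕₚ.*-monoʳ-≤ r (size≤ b))) p ⟩
        N + r * N + (N + z)        ≡⟨ e₂ r N z ⟩
        (N + u * N) + z            ∎)
    , (begin
        (N + u * N) + u * Z        ≡⟨ e₃ r N Z ⟩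
        u * N + r * Z + (N + Z)    ≤⟨ ℕₚ.+-mono-≤ (ℕₚ.+-monoʳ-≤ (u * N) (ℕₚ.*-monoʳ-≤ r Z≤X)) q ⟩
        u * N + r * X + (X + Y)    ≡⟨ e₄ r N X Y ⟩
        u * X + (u * N + Y)        ∎))
    where
    open ≤-Reasoning
    N = t ^ n
    x = size a
    y = size b
    z = size c
    X = bdry a
    Y = bdry b
    Z = bdry c
    -- From N + Z ≤ X + Y and Y ≤ N. It pays for the `r` copies of Z in u·Z beyond the one in N + Z.
    Z≤X : Z ≤ X
    Z≤X = ℕₚ.+-cancelˡ-≤ N _ _ (≤-trans q (≤-trans (ℕₚ.+-monoʳ-≤ X (bdry≤ b)) (ℕₚ.≤-reflexive (ℕₚ.+-comm X N))))
    e₁ : ∀ r N x y → x + (N + suc r * y) ≡ N + r * y + (x + y)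
    e₁ = solve-∀
    e₂ : ∀ r N z → N + r * N + (N + z) ≡ (N + suc r * N) + z
    e₂ = solve-∀
    e₃ : ∀ r N Z → (N + suc r * N) + suc r * Z ≡ suc r * N + r * Z + (N + Z)
    e₃ = solve-∀
    e₄ : ∀ r N X Y → suc r * N + r * X + (X + Y) ≡ suc r * X + (suc r * N + Y)
    e₄ = solve-∀

  -- Two copies of N are present from the start. Without a carry, one copy of z is kept and the
  -- other `r` are bounded by N, so that 2N + r·N = t^(n+1) is carried and `low c` remains. With a
  -- carry, u(N + z) supplies the missing u·N directly and `high c` remains.
  high+high : ∀ {n} (a b : Seg n) → Addition a b → Addition (high a) (high b)
  high+high {n} a b (c , inj₁ (p , q)) = low c , inj₂
    ( (begin
        (N + u * x) + (N + u * y)      ≡⟨ e₁ u N x y ⟩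
        (N + N) + u * (x + y)          ≤⟨ ℕₚ.+-monoʳ-≤ (N + N) (ℕₚ.*-monoʳ-≤ u p) ⟩
        (N + N) + u * z                ≡⟨ e₂ r N z ⟩
        (N + N + z) + r * z            ≤⟨ ℕₚ.+-monoʳ-≤ (N + N + z) (ℕₚ.*-monoʳ-≤ r (size≤ c)) ⟩
        (N + N + z) + r * N            ≡⟨ e₃ r N z ⟩
        (N + u * N) + z                ∎)
    , (begin
        (N + u * N) + u * Z            ≡⟨ e₄ r N Z ⟩
        (N + u * N) + (r * Z + Z)      ≤⟨ ℕₚ.+-monoʳ-≤ (N + u * N) (ℕₚ.+-mono-≤ (ℕₚ.*-monoʳ-≤ r (bdry≤ c)) q) ⟩
        (N + u * N) + (r * N + (X + Y)) ≡⟨ e₅ r N X Y ⟩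
        (u * N + X) + (u * N + Y)      ∎))
    where
    open ≤-Reasoning
    N = t ^ n
    x = size a
    y = size b
    z = size c
    X = bdry a
    Y = bdry b
    Z = bdry c
    e₁ : ∀ u N x y → (N + u * x) + (N + u * y) ≡ (N + N) + u * (x + y)
    e₁ = solve-∀
    e₂ : ∀ r N z → (N + N) + suc r * z ≡ (N + N + z) + r * z
    e₂ = solve-∀
    e₃ : ∀ r N z → (N + N + z) + r * N ≡ (N + suc r * N) + z
    e₃ = solve-∀
    e₄ : ∀ r N Z → (N + suc r * N) + suc r * Z ≡ (N + suc r * N) + (r * Z + Z)
    e₄ = solve-∀
    e₅ : ∀ r N X Y → (N + suc r * N) + (r * N + (X + Y)) ≡ (suc r * N + X) + (suc r * N + Y)
    e₅ = solve-∀
  high+high {n} a b (c , inj₂ (p , q)) = high c , inj₂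
    ( (begin
        (N + u * x) + (N + u * y)      ≡⟨ e₁ u N x y ⟩
        (N + N) + u * (x + y)          ≤⟨ ℕₚ.+-monoʳ-≤ (N + N) (ℕₚ.*-monoʳ-≤ u p) ⟩
        (N + N) + u * (N + z)          ≡⟨ e₂ u N z ⟩
        (N + u * N) + (N + u * z)      ∎)
    , (begin
        (N + u * N) + (u * N + Z)      ≡⟨ e₃ u N Z ⟩
        (u * N + u * N) + (N + Z)      ≤⟨ ℕₚ.+-monoʳ-≤ (u * N + u * N) q ⟩
        (u * N + u * N) + (X + Y)      ≡⟨ e₄ u N X Y ⟩
        (u * N + X) + (u * N + Y)      ∎))
    where
    open ≤-Reasoning
    N = t ^ n
    x = size a
    y = size b
    z = size c
    X = bdry a
    Y = bdry b
    Z = bdry c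
    e₁ : ∀ u N x y → (N + u * x) + (N + u * y) ≡ (N + N) + u * (x + y)
    e₁ = solve-∀
    e₂ : ∀ u N z → (N + N) + u * (N + z) ≡ (N + u * N) + (N + u * z)
    e₂ = solve-∀
    e₃ : ∀ u N Z → (N + u * N) + (u * N + Z) ≡ (u * N + u * N) + (N + Z)
    e₃ = solve-∀
    e₄ : ∀ u N X Y → (u * N + u * N) + (X + Y) ≡ (u * N + X) + (u * N + Y)
    e₄ = solve-∀

  -- By recursion on the leading symbols. In dimension 0 two points already carry: 1 + 1 = t^0 + 1.
  add : ∀ {n} (a b : Seg n) → Addition a b
  add none b = b , inj₁ (≤-refl , ≤-refl)
  add all none = all , inj₁ (≤-refl , ≤-refl)
  add all all = all , inj₂ (≤-refl , ≤-refl)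
  add (low a) (low b) = low+low a b (add a b)
  add (low a) (high b) = low+high a b (add a b)
  add (high a) (low b) = Addition-sym (low b) (high a) (low+high b a (Addition-sym a b (add a b)))
  add (high a) (high b) = high+high a b (add a b)

  -- The bounds are the size and the boundary of the set {0}×b ∪ {1,...,u}×a: layer 0 sees only
  -- copies of a, every other layer sees the larger b. A common leading symbol passes through this
  -- construction, so that only `low⊑high` needs `add`.
  merge : ∀ {n} {a b : Seg n} → a ⊑ b →
    ∃ λ (c : Seg (suc n)) → size b + u * size a ≤ size c × bdry c ≤ u * bdry b + bdry a
  merge {b = none} none⊑ = low none , ℕₚ.≤-reflexive (ℕₚ.*-zeroʳ u) , ℕₚ.m≤m+n _ _
  merge {b = all} none⊑ = low all , ℕₚ.≤-reflexive (cong suc (ℕₚ.*-zeroʳ u)) , ℕₚ.m≤m+n _ _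
  merge all⊑all = high all , ≤-refl , ≤-refl
  merge (low⊑low {a = a} {b} le) with merge le
  ... | c , p , q = low c , p , ≤-trans (ℕₚ.*-monoʳ-≤ u q) (ℕₚ.≤-reflexive (ℕₚ.*-distribˡ-+ u (u * bdry b) _))
  merge {suc n} (high⊑high {a = a} {b} le) with merge le
  ... | c , p , q = high c
    , (begin
        (N + u * size b) + u * (N + u * size a)  ≡⟨ e₁ u N (size a) (size b) ⟩
        (N + u * N) + u * (size b + u * size a)  ≤⟨ ℕₚ.+-monoʳ-≤ (N + u * N) (ℕₚ.*-monoʳ-≤ u p) ⟩
        (N + u * N) + u * size c                 ∎)
    , (begin
        u * (N + u * N) + bdry c                 ≤⟨ ℕₚ.+-monoʳ-≤ (u * (N + u * N)) q ⟩
        u * (N + u * N) + (u * bdry b + bdry a)  ≡⟨ e₂ u N (bdry a) (bdry b) ⟩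
        u * (u * N + bdry b) + (u * N + bdry a)  ∎)
    where
    open ≤-Reasoning
    N = t ^ n
    e₁ : ∀ u N x y → (N + u * y) + u * (N + u * x) ≡ (N + u * N) + u * (y + u * x)
    e₁ = solve-∀
    e₂ : ∀ u N X Y → u * (N + u * N) + (u * Y + X) ≡ u * (u * N + Y) + (u * N + X)
    e₂ = solve-∀
  -- Only sums enter: the size is N + u(x + y) and the boundary u(u·N + X + Y), which is where `add`
  -- applies.
  merge {suc n} (low⊑high {a = a} {b}) with add a b
  ... | c , inj₁ (p , q) = low (high c)
    , (begin
        (N + u * size b) + u * size a            ≡⟨ e₁ u N (size a) (size b) ⟩
        N + u * (size a + size b)                ≤⟨ ℕₚ.+-monoʳ-≤ N (ℕₚ.*-monoʳ-≤ u p) ⟩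
        N + u * size c                           ∎)
    , (begin
        u * (u * N + bdry c)                     ≤⟨ ℕₚ.*-monoʳ-≤ u (ℕₚ.+-monoʳ-≤ (u * N) q) ⟩
        u * (u * N + (bdry a + bdry b))          ≡⟨ e₂ u N (bdry a) (bdry b) ⟩
        u * (u * N + bdry b) + u * bdry a        ∎)
    where
    open ≤-Reasoning
    N = t ^ n
    e₁ : ∀ u N x y → (N + u * y) + u * x ≡ N + u * (x + y)
    e₁ = solve-∀
    e₂ : ∀ u N X Y → u * (u * N + (X + Y)) ≡ u * (u * N + Y) + u * X
    e₂ = solve-∀
  -- After a carry, N + u(N + z) = t^(n+1) + u·z: the carry completes layer 0, and `low c` goes into
  -- each of the other layers.
  ... | c , inj₂ (p , q) = high (low c)
    , (begin
        (N + u * size b) + u * size a            ≡⟨ e₁ u N (size a) (size b) ⟩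
        N + u * (size a + size b)                ≤⟨ ℕₚ.+-monoʳ-≤ N (ℕₚ.*-monoʳ-≤ u p) ⟩
        N + u * (N + size c)                     ≡⟨ e₂ u N (size c) ⟩
        (N + u * N) + u * size c                 ∎)
    , (begin
        u * (N + u * N) + u * bdry c             ≡⟨ e₃ u N (bdry c) ⟩
        u * (u * N + (N + bdry c))               ≤⟨ ℕₚ.*-monoʳ-≤ u (ℕₚ.+-monoʳ-≤ (u * N) q) ⟩
        u * (u * N + (bdry a + bdry b))          ≡⟨ e₄ u N (bdry a) (bdry b) ⟩
        u * (u * N + bdry b) + u * bdry a        ∎)
    where
    open ≤-Reasoning
    N = t ^ n
    e₁ : ∀ u N x y → (N + u * y) + u * x ≡ N + u * (x + y)
    e₁ = solve-∀
    e₂ : ∀ u N z → N + u * (N + z) ≡ (N + u * N) + u * z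
    e₂ = solve-∀
    e₃ : ∀ u N Z → u * (N + u * N) + u * Z ≡ u * (u * N + (N + Z))
    e₃ = solve-∀
    e₄ : ∀ u N X Y → u * (u * N + (X + Y)) ≡ u * (u * N + Y) + u * X
    e₄ = solve-∀

-- Counting vertices

module Counting where
  open import Data.Nat using (_+_; _*_)
  open import Algebra.Properties.CommutativeMonoid.Sum +-0-commutativeMonoid using (sum; ∑-comm; ∑-distrib-+; sum-cong-≗)
  open import Algebra.Properties.Semiring.Sum +-*-semiring using (*-distribˡ-sum)

  sum-mono : ∀ {m} {f g : Fin m → ℕ} → (∀ i → f i ≤ g i) → sum f ≤ sum g
  sum-mono {zero} f≤g = z≤n
  sum-mono {suc m} f≤g = ℕₚ.+-mono-≤ (f≤g zero) (sum-mono (λ i → f≤g (suc i)))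

  sum-const : ∀ m c → sum {m} (λ _ → c) ≡ m * c
  sum-const zero c = refl
  sum-const (suc m) c = cong (c +_) (sum-const m c)

  sum-except : ∀ {m} (f : Fin (suc m) → ℕ) i → (∀ j → j ≢ i → 1 ≤ f j) → m ≤ sum f
  sum-except {m} f zero 1≤f = begin
    m                           ≡⟨ ℕₚ.*-identityʳ m ⟨
    m * 1                       ≡⟨ sum-const m 1 ⟨
    sum {m} (λ _ → 1)           ≤⟨ sum-mono (λ j → 1≤f (suc j) (λ ())) ⟩
    sum (λ j → f (suc j))       ≤⟨ ℕₚ.m≤n+m _ (f zero) ⟩
    f zero + sum (λ j → f (suc j)) ∎
    where open ≤-Reasoning
  sum-except {suc m} f (suc i) 1≤f =
    ℕₚ.+-mono-≤ (1≤f zero (λ ())) (sum-except (λ j → f (suc j)) i (λ j j≢i → 1≤f (suc j) (λ e → j≢i (suc-injective e))))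

  T-does⁺ : ∀ {P : Set} (P? : Dec P) → P → T (does P?)
  T-does⁺ (yes _) _ = _
  T-does⁺ (no ¬p) p = ⊥-elim (¬p p)

  T-does⁻ : ∀ {P : Set} (P? : Dec P) → T (does P?) → P
  T-does⁻ (yes p) _ = p

  𝟙 : Bool → ℕ
  𝟙 b = if b then 1 else 0

  𝟙≤1 : ∀ b → 𝟙 b ≤ 1
  𝟙≤1 true = ≤-refl
  𝟙≤1 false = z≤n

  T⇒1≤𝟙 : ∀ {b} → T b → 1 ≤ 𝟙 b
  T⇒1≤𝟙 {true} _ = ≤-refl

  𝟙-mono : ∀ {a b} → (T a → T b) → 𝟙 a ≤ 𝟙 b
  𝟙-mono {false} _ = z≤n
  𝟙-mono {true} {true} _ = ≤-refl
  𝟙-mono {true} {false} a⇒b = ⊥-elim (a⇒b _)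

  ¬T⇒𝟙≤0 : ∀ {b} → ¬ T b → 𝟙 b ≤ 0
  ¬T⇒𝟙≤0 {false} _ = z≤n
  ¬T⇒𝟙≤0 {true} ¬b = ⊥-elim (¬b _)

  sum-at-most-one : ∀ {m} (P : Fin m → Bool) → (∀ i j → T (P i) → T (P j) → i ≡ j) → sum (λ i → 𝟙 (P i)) ≤ 1
  sum-at-most-one {zero} P uniq = z≤n
  sum-at-most-one {suc m} P uniq with P zero in eq
  ... | false = sum-at-most-one (λ i → P (suc i)) (λ i j p q → suc-injective (uniq (suc i) (suc j) p q))
  ... | true = s≤s (begin
    sum (λ i → 𝟙 (P (suc i)))  ≤⟨ sum-mono (λ i → ¬T⇒𝟙≤0 (λ p → 0≢1+n (uniq zero (suc i) (subst T (sym eq) _) p))) ⟩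
    sum {m} (λ _ → 0)          ≡⟨ sum-const m 0 ⟩
    m * 0                      ≡⟨ ℕₚ.*-zeroʳ m ⟩
    0                          ∎)
    where open ≤-Reasoning

  -- Sums over vertices, by layers and by fibres

  module _ {t : ℕ} where

    -- Recurses on the first coordinate as `allVertices` does, so that `card` unfolds layer by
    -- layer.
    ∑ᵛ : ∀ {n} → (Vertex t n → ℕ) → ℕ
    ∑ᵛ {zero} f = f []
    ∑ᵛ {suc n} f = sum (λ a → ∑ᵛ (λ v → f (a ∷ v)))

    ∑ᵛ-mono : ∀ {n} {f g : Vertex t n → ℕ} → (∀ v → f v ≤ g v) → ∑ᵛ f ≤ ∑ᵛ g
    ∑ᵛ-mono {zero} f≤g = f≤g []
    ∑ᵛ-mono {suc n} f≤g = sum-mono (λ a → ∑ᵛ-mono (λ v → f≤g (a ∷ v)))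

    ∑ᵛ-distrib-+ : ∀ {n} (f g : Vertex t n → ℕ) → ∑ᵛ (λ v → f v + g v) ≡ ∑ᵛ f + ∑ᵛ g
    ∑ᵛ-distrib-+ {zero} f g = refl
    ∑ᵛ-distrib-+ {suc n} f g = trans
      (sum-cong-≗ (λ a → ∑ᵛ-distrib-+ (λ v → f (a ∷ v)) (λ v → g (a ∷ v))))
      (∑-distrib-+ (λ a → ∑ᵛ (λ v → f (a ∷ v))) (λ a → ∑ᵛ (λ v → g (a ∷ v))))

    *-distribˡ-∑ᵛ : ∀ {n} k (f : Vertex t n → ℕ) → k * ∑ᵛ f ≡ ∑ᵛ (λ v → k * f v)
    *-distribˡ-∑ᵛ {zero} k f = refl
    *-distribˡ-∑ᵛ {suc n} k f = trans
      (*-distribˡ-sum k (λ a → ∑ᵛ (λ v → f (a ∷ v))))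
      (sum-cong-≗ (λ a → *-distribˡ-∑ᵛ k (λ v → f (a ∷ v))))

    ∑ᵛ-const : ∀ n c → ∑ᵛ {n} (λ _ → c) ≡ t ^ n * c
    ∑ᵛ-const zero c = sym (ℕₚ.*-identityˡ c)
    ∑ᵛ-const (suc n) c = trans (sum-cong-≗ {t} (λ _ → ∑ᵛ-const n c))
      (trans (sum-const t (t ^ n * c)) (sym (ℕₚ.*-assoc t (t ^ n) c)))

    sum-∑ᵛ-comm : ∀ {m n} (f : Fin m → Vertex t n → ℕ) → sum (λ i → ∑ᵛ (f i)) ≡ ∑ᵛ (λ v → sum (λ i → f i v))
    sum-∑ᵛ-comm {n = zero} f = refl
    sum-∑ᵛ-comm {n = suc n} f = trans
      (∑-comm (λ i a → ∑ᵛ (λ v → f i (a ∷ v))))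
      (sum-cong-≗ (λ a → sum-∑ᵛ-comm (λ i v → f i (a ∷ v))))

    -- Exchanges the summations: `card` counts by layers, whereas the bounds through `some` and
    -- `many` count by fibres.
    ∑ᵛ-fibres : ∀ {n} (f : Vertex t (suc n) → ℕ) → ∑ᵛ f ≡ ∑ᵛ (λ v → sum (λ a → f (a ∷ v)))
    ∑ᵛ-fibres f = sum-∑ᵛ-comm (λ a v → f (a ∷ v))

    private
      count-map : ∀ {A B : Set} (P : B → Bool) (h : A → B) xs →
        length (filterᵇ P (map h xs)) ≡ length (filterᵇ (λ x → P (h x)) xs)
      count-map P h [] = refl
      count-map P h (x ∷ xs) with P (h x)
      ... | true = cong suc (count-map P h xs)
      ... | false = count-map P h xs

      -- `tabulate g` with arbitrary `g` keeps the induction going, since the tail of `allFin`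
      -- tabulates shifted indices; `allFin` itself is the case of the identity.
      count-concatMap : ∀ {A B : Set} {m} (P : B → Bool) (h : A → List B) (g : Fin m → A) →
        length (filterᵇ P (concatMap h (tabulate g))) ≡ sum (λ i → length (filterᵇ P (h (g i))))
      count-concatMap {m = zero} P h g = refl
      count-concatMap {m = suc m} P h g
        rewrite filter-++ (λ x → T? (P x)) (h (g zero)) (concatMap h (tabulate (λ i → g (suc i))))
              | length-++ (filterᵇ P (h (g zero))) {filterᵇ P (concatMap h (tabulate (λ i → g (suc i))))}
        = cong (length (filterᵇ P (h (g zero))) +_) (count-concatMap P h (λ i → g (suc i)))

    card-∑ᵛ : ∀ {n} (S : Subset t n) → card S ≡ ∑ᵛ (λ v → 𝟙 (S v))
    card-∑ᵛ {zero} S with S []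
    ... | true = refl
    ... | false = refl
    card-∑ᵛ {suc n} S = trans
      (count-concatMap S (λ a → map (a ∷_) (allVertices t n)) (λ i → i))
      (sum-cong-≗ (λ a → trans (count-map S (a ∷_) (allVertices t n)) (card-∑ᵛ (λ v → S (a ∷ v)))))

    card-mono : ∀ {n} (S R : Subset t n) → (∀ v → T (S v) → T (R v)) → card S ≤ card R
    card-mono S R S⊆R rewrite card-∑ᵛ S | card-∑ᵛ R = ∑ᵛ-mono (λ v → 𝟙-mono (S⊆R v))

    card-fibres : ∀ {n} (S : Subset t (suc n)) → card S ≡ ∑ᵛ (λ v → sum (λ a → 𝟙 (S (a ∷ v))))
    card-fibres S = trans (card-∑ᵛ S) (∑ᵛ-fibres (λ v → 𝟙 (S v)))

    ∑ᵛ-card-linear : ∀ {n} k l (S R : Subset t n) →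
      ∑ᵛ (λ v → k * 𝟙 (S v) + l * 𝟙 (R v)) ≡ k * card S + l * card R
    ∑ᵛ-card-linear k l S R rewrite card-∑ᵛ S | card-∑ᵛ R
      | *-distribˡ-∑ᵛ k (λ v → 𝟙 (S v)) | *-distribˡ-∑ᵛ l (λ v → 𝟙 (R v))
      = ∑ᵛ-distrib-+ (λ v → k * 𝟙 (S v)) (λ v → l * 𝟙 (R v))

    ∈-allVertices : ∀ {n} (v : Vertex t n) → v ∈ allVertices t n
    ∈-allVertices [] = here refl
    ∈-allVertices (a ∷ v) = ∈-concat⁺′ (∈-map⁺ (a ∷_) (∈-allVertices v)) (∈-map⁺ _ (∈-allFin a))

    ∂⁺ : ∀ {n} (S : Subset t n) x y → T (S y) → Adjacent x y → T (∂ S x)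
    ∂⁺ S x y Sy x~y = any⁺ (λ y → S y ∧ adjacent? x y)
      (lose (∈-allVertices y) (Equivalence.from T-∧ (Sy , T-does⁺ (all? (λ i → ¬? (lookup x i ≟ᶠ lookup y i))) x~y)))

    ∂⁻ : ∀ {n} (S : Subset t n) x → T (∂ S x) → ∃ λ y → T (S y) × Adjacent x y
    ∂⁻ S x p with find (any⁻ (λ y → S y ∧ adjacent? x y) (allVertices t _) p)
    ... | y , _ , q = let Sy , adj = Equivalence.to T-∧ q in y , Sy , T-does⁻ (all? (λ i → ¬? (lookup x i ≟ᶠ lookup y i))) adj

    ∂-mono : ∀ {n} {S R : Subset t n} → (∀ v → T (S v) → T (R v)) → ∀ x → T (∂ S x) → T (∂ R x)
    ∂-mono {S = S} {R} S⊆R x p = let y , Sy , x~y = ∂⁻ S x p in ∂⁺ R x y (S⊆R y Sy) x~y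

    ∷-adjacent : ∀ {n} {a b} (x y : Vertex t n) → a ≢ b → Adjacent x y → Adjacent (a ∷ x) (b ∷ y)
    ∷-adjacent x y a≢b x~y zero = a≢b
    ∷-adjacent x y a≢b x~y (suc i) = x~y i

  -- Fibres along the first coordinate: the sets P (`some`) and Q (`many`)

  Some Many : ∀ {t n} → Subset t (suc n) → Vertex t n → Set
  Some S v = ∃ λ a → T (S (a ∷ v))
  Many S v = ∃ λ a → ∃ λ b → a ≢ b × T (S (a ∷ v)) × T (S (b ∷ v))

  some? : ∀ {t n} (S : Subset t (suc n)) v → Dec (Some S v)
  some? S v = any? (λ a → T? (S (a ∷ v)))

  many? : ∀ {t n} (S : Subset t (suc n)) v → Dec (Many S v)
  many? S v = any? (λ a → any? (λ b → ¬? (a ≟ᶠ b) ×-dec T? (S (a ∷ v)) ×-dec T? (S (b ∷ v))))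

  some many : ∀ {t n} → Subset t (suc n) → Subset t n
  some S v = does (some? S v)
  many S v = does (many? S v)

  many⊆some : ∀ {t n} (S : Subset t (suc n)) v → T (many S v) → T (some S v)
  many⊆some S v p = let a , _ , _ , Sa , _ = T-does⁻ (many? S v) p in T-does⁺ (some? S v) (a , Sa)

  module _ {u : ℕ} where

    -- A fibre holds no point, one point, or at most 1 + u points, according to the two decisions.
    -- They are arguments so that matching on them evaluates `does`; the factor 1 gives the shape
    -- that `∑ᵛ-card-linear` sums.
    fibre-≤ : ∀ {n} (S : Subset (suc u) (suc n)) v (some? : Dec (Some S v)) (many? : Dec (Many S v)) →
      sum (λ a → 𝟙 (S (a ∷ v))) ≤ 1 * 𝟙 (does some?) + u * 𝟙 (does many?)
    fibre-≤ S v (no ¬some) (no _) = begin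
      sum (λ a → 𝟙 (S (a ∷ v)))  ≤⟨ sum-mono (λ a → ¬T⇒𝟙≤0 (λ p → ¬some (a , p))) ⟩
      sum {suc u} (λ _ → 0)      ≡⟨ sum-const (suc u) 0 ⟩
      u * 0                      ∎
      where open ≤-Reasoning
    fibre-≤ S v (no ¬some) (yes (a , _ , _ , p , _)) = ⊥-elim (¬some (a , p))
    fibre-≤ S v (yes _) (no ¬many) = ≤-trans
      (sum-at-most-one (λ a → S (a ∷ v)) (λ a b p q → decidable-stable (a ≟ᶠ b) (λ a≢b → ¬many (a , b , a≢b , p , q))))
      (ℕₚ.m≤m+n 1 _)
    fibre-≤ S v (yes _) (yes _) = ≤-trans (sum-mono (λ a → 𝟙≤1 (S (a ∷ v)))) (ℕₚ.≤-reflexive (sum-const (suc u) 1))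

    -- If x is adjacent to some y with `a ∷ y` in S, then every `b ∷ x` with b ≠ a is in the
    -- boundary, which gives u points. If the fibre over y contains a second point `a′ ∷ y`, that
    -- point also reaches `a ∷ x`, and the whole fibre over x is in the boundary.
    ∂-fibre-≥ : ∀ {n} (S : Subset (suc u) (suc n)) x →
      u * 𝟙 (∂ (some S) x) + 1 * 𝟙 (∂ (many S) x) ≤ sum (λ b → 𝟙 (∂ S (b ∷ x)))
    ∂-fibre-≥ S x with ∂ (some S) x in eqs | ∂ (many S) x in eqm
    ... | false | false rewrite ℕₚ.*-zeroʳ u = z≤n
    ... | false | true = ⊥-elim (subst T eqs (∂-mono {S = many S} {some S} (many⊆some S) x (subst T (sym eqm) _)))
    ... | true | false = let
        y , p , x~y = ∂⁻ (some S) x (subst T (sym eqs) _)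
        a , Say = T-does⁻ (some? S y) p
      in ≤-trans (ℕₚ.≤-reflexive (trans (ℕₚ.+-identityʳ _) (ℕₚ.*-identityʳ u)))
        (sum-except (λ b → 𝟙 (∂ S (b ∷ x))) a (λ b b≢a → T⇒1≤𝟙 (∂⁺ S (b ∷ x) (a ∷ y) Say (∷-adjacent x y b≢a x~y))))
    ... | true | true = let
        y , p , x~y = ∂⁻ (many S) x (subst T (sym eqm) _)
        a , a′ , a≢a′ , Sa , Sa′ = T-does⁻ (many? S y) p
        all-b : ∀ b → T (∂ S (b ∷ x))
        all-b b = case b ≟ᶠ a of λ where
          (no b≢a) → ∂⁺ S (b ∷ x) (a ∷ y) Sa (∷-adjacent x y b≢a x~y)
          (yes refl) → ∂⁺ S (a ∷ x) (a′ ∷ y) Sa′ (∷-adjacent x y a≢a′ x~y)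
      in begin
        u * 1 + 1                      ≡⟨ ℕₚ.+-comm (u * 1) 1 ⟩
        suc u * 1                      ≡⟨ sum-const (suc u) 1 ⟨
        sum {suc u} (λ _ → 1)          ≤⟨ sum-mono (λ b → T⇒1≤𝟙 (all-b b)) ⟩
        sum (λ b → 𝟙 (∂ S (b ∷ x)))    ∎
      where open ≤-Reasoning

    card-≤ : ∀ {n} (S : Subset (suc u) (suc n)) → card S ≤ card (some S) + u * card (many S)
    card-≤ S = begin
      card S                                           ≡⟨ card-fibres S ⟩
      ∑ᵛ (λ v → sum (λ a → 𝟙 (S (a ∷ v))))             ≤⟨ ∑ᵛ-mono (λ v → fibre-≤ S v (some? S v) (many? S v)) ⟩
      ∑ᵛ (λ v → 1 * 𝟙 (some S v) + u * 𝟙 (many S v))   ≡⟨ ∑ᵛ-card-linear 1 u (some S) (many S) ⟩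
      1 * card (some S) + u * card (many S)            ≡⟨ cong (_+ u * card (many S)) (ℕₚ.*-identityˡ _) ⟩
      card (some S) + u * card (many S)                ∎
      where open ≤-Reasoning

    card-∂-≥ : ∀ {n} (S : Subset (suc u) (suc n)) → u * card (∂ (some S)) + card (∂ (many S)) ≤ card (∂ S)
    card-∂-≥ S = begin
      u * card (∂ (some S)) + card (∂ (many S))                ≡⟨ cong (u * card (∂ (some S)) +_) (ℕₚ.*-identityˡ _) ⟨
      u * card (∂ (some S)) + 1 * card (∂ (many S))            ≡⟨ ∑ᵛ-card-linear u 1 (∂ (some S)) (∂ (many S)) ⟨
      ∑ᵛ (λ v → u * 𝟙 (∂ (some S) v) + 1 * 𝟙 (∂ (many S) v))   ≤⟨ ∑ᵛ-mono (∂-fibre-≥ S) ⟩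
      ∑ᵛ (λ x → sum (λ b → 𝟙 (∂ S (b ∷ x))))                   ≡⟨ card-fibres (∂ S) ⟨
      card (∂ S)                                               ∎
      where open ≤-Reasoning

    -- The sets behind `low` and `high`

    Low High : ∀ {n} → Subset (suc u) n → Subset (suc u) (suc n)
    Low R (zero ∷ v) = R v
    Low R (suc _ ∷ v) = false
    High R (zero ∷ v) = true
    High R (suc _ ∷ v) = R v

    private
      ∂-Low⊆ : ∀ {n} (R : Subset (suc u) n) b x → T (∂ (Low R) (b ∷ x)) → b ≢ zero × T (∂ R x)
      ∂-Low⊆ R b x p with ∂⁻ (Low R) (b ∷ x) p
      ... | zero ∷ y , Ry , bx~y = bx~y zero , ∂⁺ R x y Ry (λ i → bx~y (suc i))

      ∂-High⊆ : ∀ {n} (R : Subset (suc u) n) x → T (∂ (High R) (zero ∷ x)) → T (∂ R x)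
      ∂-High⊆ R x p with ∂⁻ (High R) (zero ∷ x) p
      ... | zero ∷ y , _ , 0x~y = ⊥-elim (0x~y zero refl)
      ... | suc _ ∷ y , Ry , 0x~y = ∂⁺ R x y Ry (λ i → 0x~y (suc i))

    card-Low : ∀ {n} (R : Subset (suc u) n) → card R ≤ card (Low R)
    card-Low R rewrite card-∑ᵛ (Low R) | card-∑ᵛ R = ℕₚ.m≤m+n _ _

    card-High : ∀ {n} (R : Subset (suc u) n) → suc u ^ n + u * card R ≤ card (High R)
    card-High {n} R rewrite card-∑ᵛ (High R) | card-∑ᵛ R = ℕₚ.≤-reflexive (sym (cong₂ _+_
      (trans (∑ᵛ-const n 1) (ℕₚ.*-identityʳ _)) (sum-const u _)))

    -- Adjacent vertices differ in the first coordinate, so layer 0 contributes nothing and each of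
    -- the other `u` layers at most the boundary of R.
    card-∂-Low : ∀ {n} (R : Subset (suc u) n) → card (∂ (Low R)) ≤ u * card (∂ R)
    card-∂-Low {n} R rewrite card-∑ᵛ (∂ (Low R)) | card-∑ᵛ (∂ R) = begin
      ∑ᵛ (λ x → 𝟙 (∂ (Low R) (zero ∷ x))) + sum (λ b → ∑ᵛ (λ x → 𝟙 (∂ (Low R) (suc b ∷ x))))
        ≤⟨ ℕₚ.+-mono-≤
             (∑ᵛ-mono (λ x → ¬T⇒𝟙≤0 (λ p → proj₁ (∂-Low⊆ R zero x p) refl)))
             (sum-mono (λ b → ∑ᵛ-mono (λ x → 𝟙-mono (λ p → proj₂ (∂-Low⊆ R (suc b) x p))))) ⟩
      ∑ᵛ {suc u} {n} (λ _ → 0) + sum {u} (λ _ → ∑ᵛ (λ x → 𝟙 (∂ R x)))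
        ≡⟨ cong₂ _+_ (trans (∑ᵛ-const n 0) (ℕₚ.*-zeroʳ (suc u ^ n))) (sum-const u _) ⟩
      u * ∑ᵛ (λ x → 𝟙 (∂ R x)) ∎
      where open ≤-Reasoning

    -- From layer 0 only the copies of R are visible, not the full layer itself; the other `u`
    -- layers are counted in full.
    card-∂-High : ∀ {n} (R : Subset (suc u) n) → card (∂ (High R)) ≤ u * suc u ^ n + card (∂ R)
    card-∂-High {n} R rewrite card-∑ᵛ (∂ (High R)) | card-∑ᵛ (∂ R) = begin
      ∑ᵛ (λ x → 𝟙 (∂ (High R) (zero ∷ x))) + sum (λ b → ∑ᵛ (λ x → 𝟙 (∂ (High R) (suc b ∷ x))))
        ≤⟨ ℕₚ.+-mono-≤
             (∑ᵛ-mono (λ x → 𝟙-mono (∂-High⊆ R x)))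
             (sum-mono {u} (λ b → ∑ᵛ-mono (λ x → 𝟙≤1 (∂ (High R) (suc b ∷ x))))) ⟩
      ∑ᵛ (λ x → 𝟙 (∂ R x)) + sum {u} (λ _ → ∑ᵛ {suc u} {n} (λ _ → 1))
        ≡⟨ ℕₚ.+-comm (∑ᵛ (λ x → 𝟙 (∂ R x))) _ ⟩
      sum {u} (λ _ → ∑ᵛ {suc u} {n} (λ _ → 1)) + ∑ᵛ (λ x → 𝟙 (∂ R x))
        ≡⟨ cong (_+ ∑ᵛ (λ x → 𝟙 (∂ R x))) (trans (sum-const u _) (cong (u *_) (trans (∑ᵛ-const n 1) (ℕₚ.*-identityʳ _)))) ⟩
      u * suc u ^ n + ∑ᵛ (λ x → 𝟙 (∂ R x)) ∎
      where open ≤-Reasoning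

-- Segments as extremal sets

module Extremal (r : ℕ) where
  open import Data.Nat using (_+_; _*_)
  open Segments r
  open Counting

  ⟦_⟧ : ∀ {n} → Seg n → Subset t n
  ⟦ none ⟧ _ = false
  ⟦ all ⟧ _ = true
  ⟦ low s ⟧ = Low ⟦ s ⟧
  ⟦ high s ⟧ = High ⟦ s ⟧

  card-⟦⟧ : ∀ {n} (s : Seg n) → size s ≤ card ⟦ s ⟧
  card-⟦⟧ none = z≤n
  card-⟦⟧ all = ≤-refl
  card-⟦⟧ (low s) = ≤-trans (card-⟦⟧ s) (card-Low ⟦ s ⟧)
  card-⟦⟧ {suc n} (high s) = ≤-trans (ℕₚ.+-monoʳ-≤ (t ^ n) (ℕₚ.*-monoʳ-≤ u (card-⟦⟧ s))) (card-High ⟦ s ⟧)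

  card-∂-⟦⟧ : ∀ {n} (s : Seg n) → card (∂ ⟦ s ⟧) ≤ bdry s
  card-∂-⟦⟧ none = z≤n
  card-∂-⟦⟧ all = ≤-refl
  card-∂-⟦⟧ (low s) = ≤-trans (card-∂-Low ⟦ s ⟧) (ℕₚ.*-monoʳ-≤ u (card-∂-⟦⟧ s))
  card-∂-⟦⟧ {suc n} (high s) = ≤-trans (card-∂-High ⟦ s ⟧) (ℕₚ.+-monoʳ-≤ (u * t ^ n) (card-∂-⟦⟧ s))

  -- `card-≤` and `card-∂-≥` have the shape of the two inequalities of `merge`, with `some S` in the
  -- role of b and `many S` in that of a.
  segment : ∀ {n} (S : Subset t n) → ∃ λ (s : Seg n) → card S ≤ size s × bdry s ≤ card (∂ S)
  segment {zero} S with S []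
  ... | false = none , z≤n , z≤n
  ... | true = all , ≤-refl , ≤-refl
  segment {suc n} S =
    let a , a≥ , a≤ = segment (many S)
        b , b≥ , b≤ = segment (some S)
        a′ , a′⊑b , a′≥ , a′≤ = below a b (≤-trans (card-mono (many S) (some S) (many⊆some S)) b≥) a≥ a≤
        c , c≥ , c≤ = merge a′⊑b
    in c , ≤-trans (card-≤ S) (≤-trans (ℕₚ.+-mono-≤ b≥ (ℕₚ.*-monoʳ-≤ u a′≥)) c≥)
         , ≤-trans c≤ (≤-trans (ℕₚ.+-mono-≤ (ℕₚ.*-monoʳ-≤ u b≤) a′≤) (card-∂-≥ S))
    where
    -- Restores the nesting that merge needs.
    below : ∀ {n} (a b : Seg n) {k l} → k ≤ size b → k ≤ size a → bdry a ≤ l →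
      ∃ λ (a′ : Seg n) → a′ ⊑ b × k ≤ size a′ × bdry a′ ≤ l
    below a b k≤b k≤a a≤l with ⊑-total a b
    ... | inj₁ a⊑b = a , a⊑b , k≤a , a≤l
    -- Here b replaces a: it is large enough because `many S` is contained in `some S`, and its
    -- boundary is no larger than that of a.
    ... | inj₂ b⊑a = b , ⊑-refl , k≤b , ≤-trans (bdry-mono b⊑a) a≤l

  -- The cylinder over a segment; Φ ranges over dimensions ≥ 1 only, so a dimension has to be gained
  -- before the first coordinate of a segment is dropped.
  pad : ∀ {n} → Seg n → Seg (suc n)
  pad none = low none
  pad all = high all
  pad (low s) = low (pad s)
  pad (high s) = high (pad s)

  size-pad : ∀ {n} (s : Seg n) → size (pad s) ≡ t * size s
  size-pad none = sym (ℕₚ.*-zeroʳ t)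
  size-pad all = refl
  size-pad (low s) = size-pad s
  size-pad {suc n} (high s) rewrite size-pad s = e t u (t ^ n) (size s)
    where
    e : ∀ t u N x → t * N + u * (t * x) ≡ t * (N + u * x)
    e = solve-∀

  bdry-pad : ∀ {n} (s : Seg n) → bdry (pad s) ≡ t * bdry s
  bdry-pad none = trans (ℕₚ.*-zeroʳ u) (sym (ℕₚ.*-zeroʳ t))
  bdry-pad all = ℕₚ.+-comm (u * 1) 1
  bdry-pad (low s) rewrite bdry-pad s = e t u (bdry s)
    where
    e : ∀ t u x → u * (t * x) ≡ t * (u * x)
    e = solve-∀
  bdry-pad {suc n} (high s) rewrite bdry-pad s = e t u (t ^ n) (bdry s)
    where
    e : ∀ t u N x → u * (t * N) + t * x ≡ t * (u * N + x)
    e = solve-∀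

  padded-segment : ∀ {n} (S : Subset t n) →
    ∃ λ (s : Seg (suc n)) → t * card S ≤ size s × bdry s ≤ t * card (∂ S)
  padded-segment S = let s , s≥ , s≤ = segment S in pad s
    , ≤-trans (ℕₚ.*-monoʳ-≤ t s≥) (ℕₚ.≤-reflexive (sym (size-pad s)))
    , ≤-trans (ℕₚ.≤-reflexive (bdry-pad s)) (ℕₚ.*-monoʳ-≤ t s≤)

-- Fractions

open import Data.Integer using (+_)
import Data.Integer as ℤ
import Data.Integer.Properties as ℤₚ
open import Data.Rational using (ℚ; _/_; _+_; _*_)
import Data.Rational as ℚ
import Data.Rational.Properties as ℚₚ
import Data.Rational.Unnormalised as ℚᵘ
import Data.Rational.Unnormalised.Properties as ℚᵘₚ

toℚᵘ-/ : ∀ a k → ℚ.toℚᵘ (+ a / suc k) ℚᵘ.≃ ℚᵘ.mkℚᵘ (+ a) k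
toℚᵘ-/ a k = ℚₚ.toℚᵘ-fromℚᵘ (ℚᵘ.mkℚᵘ (+ a) k)

/-mono-≤ : ∀ a b c d .{{_ : NonZero b}} .{{_ : NonZero d}} → a ℕ.* d ≤ c ℕ.* b → + a / b ℚ.≤ + c / d
/-mono-≤ a (suc b) c (suc d) le = ℚₚ.toℚᵘ-cancel-≤ (begin
  ℚ.toℚᵘ (+ a / suc b)  ≃⟨ toℚᵘ-/ a b ⟩
  ℚᵘ.mkℚᵘ (+ a) b       ≤⟨ ℚᵘ.*≤* (subst₂ ℤ._≤_ (ℤₚ.pos-* a (suc d)) (ℤₚ.pos-* c (suc b)) (ℤ.+≤+ le)) ⟩
  ℚᵘ.mkℚᵘ (+ c) d       ≃⟨ toℚᵘ-/ c d ⟨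
  ℚ.toℚᵘ (+ c / suc d)  ∎)
  where open ℚᵘₚ.≤-Reasoning

/-mono-< : ∀ a b c d .{{_ : NonZero b}} .{{_ : NonZero d}} → a ℕ.* d ℕ.< c ℕ.* b → + a / b ℚ.< + c / d
/-mono-< a (suc b) c (suc d) lt = ℚₚ.toℚᵘ-cancel-< (begin-strict
  ℚ.toℚᵘ (+ a / suc b)  ≃⟨ toℚᵘ-/ a b ⟩
  ℚᵘ.mkℚᵘ (+ a) b       <⟨ ℚᵘ.*<* (subst₂ ℤ._<_ (ℤₚ.pos-* a (suc d)) (ℤₚ.pos-* c (suc b)) (ℤ.+<+ lt)) ⟩
  ℚᵘ.mkℚᵘ (+ c) d       ≃⟨ toℚᵘ-/ c d ⟨
  ℚ.toℚᵘ (+ c / suc d)  ∎)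
  where open ℚᵘₚ.≤-Reasoning

/-cross : ∀ a b c d .{{_ : NonZero b}} .{{_ : NonZero d}} → a ℕ.* d ≡ c ℕ.* b → + a / b ≡ + c / d
/-cross a b c d eq = ℚₚ.≤-antisym (/-mono-≤ a b c d (ℕₚ.≤-reflexive eq)) (/-mono-≤ c d a b (ℕₚ.≤-reflexive (sym eq)))

/-*-/ : ∀ a b c d .{{_ : NonZero b}} .{{_ : NonZero d}} .{{_ : NonZero (b ℕ.* d)}} →
  (+ a / b) * (+ c / d) ≡ + (a ℕ.* c) / (b ℕ.* d)
/-*-/ a (suc b) c (suc d) = ℚₚ.toℚᵘ-injective (begin-equality
  ℚ.toℚᵘ ((+ a / suc b) * (+ c / suc d))             ≃⟨ ℚₚ.toℚᵘ-homo-* (+ a / suc b) (+ c / suc d) ⟩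
  ℚ.toℚᵘ (+ a / suc b) ℚᵘ.* ℚ.toℚᵘ (+ c / suc d)     ≃⟨ ℚᵘₚ.*-cong (toℚᵘ-/ a b) (toℚᵘ-/ c d) ⟩
  ℚᵘ.mkℚᵘ (+ a ℤ.* + c) (d ℕ.+ b ℕ.* suc d)          ≡⟨ cong (λ z → ℚᵘ.mkℚᵘ z (d ℕ.+ b ℕ.* suc d)) (sym (ℤₚ.pos-* a c)) ⟩
  ℚᵘ.mkℚᵘ (+ (a ℕ.* c)) (d ℕ.+ b ℕ.* suc d)          ≃⟨ toℚᵘ-/ (a ℕ.* c) (d ℕ.+ b ℕ.* suc d) ⟨
  ℚ.toℚᵘ (+ (a ℕ.* c) / (suc b ℕ.* suc d))           ∎)
  where open ℚᵘₚ.≤-Reasoning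

/-+-/ : ∀ a b d .{{_ : NonZero d}} → (+ a / d) + (+ b / d) ≡ + (a ℕ.+ b) / d
/-+-/ a b (suc d) = ℚₚ.toℚᵘ-injective (begin-equality
  ℚ.toℚᵘ ((+ a / suc d) + (+ b / suc d))             ≃⟨ ℚₚ.toℚᵘ-homo-+ (+ a / suc d) (+ b / suc d) ⟩
  ℚ.toℚᵘ (+ a / suc d) ℚᵘ.+ ℚ.toℚᵘ (+ b / suc d)     ≃⟨ ℚᵘₚ.+-cong (toℚᵘ-/ a d) (toℚᵘ-/ b d) ⟩
  ℚᵘ.mkℚᵘ (+ a) d ℚᵘ.+ ℚᵘ.mkℚᵘ (+ b) d               ≃⟨ ℚᵘ.*≡* e ⟩
  ℚᵘ.mkℚᵘ (+ (a ℕ.+ b)) d                            ≃⟨ toℚᵘ-/ (a ℕ.+ b) d ⟨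
  ℚ.toℚᵘ (+ (a ℕ.+ b) / suc d)                       ∎)
  where
  open ℚᵘₚ.≤-Reasoning
  e : (+ a ℤ.* + suc d ℤ.+ + b ℤ.* + suc d) ℤ.* + suc d ≡ + (a ℕ.+ b) ℤ.* (+ suc d ℤ.* + suc d)
  e = trans (cong (ℤ._* + suc d) (sym (ℤₚ.*-distribʳ-+ (+ suc d) (+ a) (+ b)))) (ℤₚ.*-assoc (+ (a ℕ.+ b)) (+ suc d) (+ suc d))

-- Affine maps between measures with denominators `N` and `t * N`

module _ (t N : ℕ) .{{_ : NonZero t}} .{{_ : NonZero N}} .{{_ : NonZero (t ℕ.* N)}} where

  scaled : ∀ v x → (+ v / t) * (+ x / N) ≡ + (v ℕ.* x) / (t ℕ.* N)
  scaled v x = /-*-/ v t x N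

  scaledʳ : ∀ v x → (+ x / N) * (+ v / t) ≡ + (v ℕ.* x) / (t ℕ.* N)
  scaledʳ v x = trans (ℚₚ.*-comm (+ x / N) (+ v / t)) (scaled v x)

  expanded : ∀ v → + v / t ≡ + (v ℕ.* N) / (t ℕ.* N)
  expanded v = /-cross v t (v ℕ.* N) (t ℕ.* N) (e v t N)
    where
    e : ∀ v t N → v ℕ.* (t ℕ.* N) ≡ v ℕ.* N ℕ.* t
    e = solve-∀

  -- For u = t - 1 the left side is the inverse of ν ↦ (tν - 1)/(t - 1), and the right side is the
  -- measure that `size` gives to `high`.
  size-affine : ∀ u x → (+ x / N) * (+ u / t) + (+ 1 / t) ≡ + (N ℕ.+ u ℕ.* x) / (t ℕ.* N)
  size-affine u x = begin
    (+ x / N) * (+ u / t) + (+ 1 / t)                          ≡⟨ cong₂ _+_ (scaledʳ u x) (expanded 1) ⟩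
    + (u ℕ.* x) / (t ℕ.* N) + + (1 ℕ.* N) / (t ℕ.* N)          ≡⟨ /-+-/ (u ℕ.* x) (1 ℕ.* N) (t ℕ.* N) ⟩
    + (u ℕ.* x ℕ.+ 1 ℕ.* N) / (t ℕ.* N)                        ≡⟨ cong (λ z → + z / (t ℕ.* N)) (e u x N) ⟩
    + (N ℕ.+ u ℕ.* x) / (t ℕ.* N)                              ∎
    where
    open ≡-Reasoning
    e : ∀ u x N → u ℕ.* x ℕ.+ 1 ℕ.* N ≡ N ℕ.+ u ℕ.* x
    e = solve-∀

  bdry-affine : ∀ u x → (+ u / t) + (+ 1 / t) * (+ x / N) ≡ + (u ℕ.* N ℕ.+ x) / (t ℕ.* N)
  bdry-affine u x = begin
    (+ u / t) + (+ 1 / t) * (+ x / N)                          ≡⟨ cong₂ _+_ (expanded u) (scaled 1 x) ⟩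
    + (u ℕ.* N) / (t ℕ.* N) + + (1 ℕ.* x) / (t ℕ.* N)          ≡⟨ /-+-/ (u ℕ.* N) (1 ℕ.* x) (t ℕ.* N) ⟩
    + (u ℕ.* N ℕ.+ 1 ℕ.* x) / (t ℕ.* N)                        ≡⟨ cong (λ z → + (u ℕ.* N ℕ.+ z) / (t ℕ.* N)) (ℕₚ.*-identityˡ x) ⟩
    + (u ℕ.* N ℕ.+ x) / (t ℕ.* N)                              ∎
    where open ≡-Reasoning

  -- Absorbs the factor `t` gained by padding: x counts in dimension n, y one dimension higher.
  /-≤-scaled : ∀ x y → t ℕ.* x ≤ y → + x / N ℚ.≤ + y / (t ℕ.* N)
  /-≤-scaled x y tx≤y = /-mono-≤ x N y (t ℕ.* N) (≤-trans (ℕₚ.≤-reflexive (e x t N)) (ℕₚ.*-monoˡ-≤ N tx≤y))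
    where
    e : ∀ x t N → x ℕ.* (t ℕ.* N) ≡ t ℕ.* x ℕ.* N
    e = solve-∀

  scaled-≤-/ : ∀ x y → y ≤ t ℕ.* x → + y / (t ℕ.* N) ℚ.≤ + x / N
  scaled-≤-/ x y y≤tx = /-mono-≤ y (t ℕ.* N) x N (≤-trans (ℕₚ.*-monoˡ-≤ N y≤tx) (ℕₚ.≤-reflexive (e x t N)))
    where
    e : ∀ x t N → t ℕ.* x ℕ.* N ≡ x ℕ.* (t ℕ.* N)
    e = solve-∀

/-monoˡ-≤ : ∀ a b d .{{_ : NonZero d}} → a ≤ b → + a / d ℚ.≤ + b / d
/-monoˡ-≤ a b d a≤b = /-mono-≤ a d b d (ℕₚ.*-monoˡ-≤ d a≤b)

-- The two cases of the recursion

module Recursion (r : ℕ) (ν : ℝ) where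
  open Segments r
  open Counting
  open Extremal r

  module _ (n : ℕ) where
    N : ℕ
    N = t ^ n

    instance
      N≢0 : NonZero N
      N≢0 = ℕₚ.m^n≢0 t n

      tN≢0 : NonZero (t ℕ.* N)
      tN≢0 = ℕₚ.m^n≢0 t (suc n)

    μ-Low : (R : Subset t n) → μ R * (+ 1 / t) ℚ.≤ μ (Low R)
    μ-Low R = ℚₚ.≤-trans (ℚₚ.≤-reflexive (scaledʳ t N 1 (card R)))
      (/-monoˡ-≤ (1 ℕ.* card R) (card (Low R)) (t ℕ.* N) (≤-trans (ℕₚ.≤-reflexive (ℕₚ.*-identityˡ (card R))) (card-Low R)))

    μ-∂-Low : (R : Subset t n) → μ (∂ (Low R)) ℚ.≤ (+ u / t) * μ (∂ R)
    μ-∂-Low R = ℚₚ.≤-trans (/-monoˡ-≤ (card (∂ (Low R))) (u ℕ.* card (∂ R)) (t ℕ.* N) (card-∂-Low R)) (ℚₚ.≤-reflexive (sym (scaled t N u (card (∂ R)))))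

    μ-High : (R : Subset t n) → μ R * (+ u / t) + (+ 1 / t) ℚ.≤ μ (High R)
    μ-High R = ℚₚ.≤-trans (ℚₚ.≤-reflexive (size-affine t N u (card R))) (/-monoˡ-≤ (N ℕ.+ u ℕ.* card R) (card (High R)) (t ℕ.* N) (card-High R))

    μ-∂-High : (R : Subset t n) → μ (∂ (High R)) ℚ.≤ (+ u / t) + (+ 1 / t) * μ (∂ R)
    μ-∂-High R = ℚₚ.≤-trans (/-monoˡ-≤ (card (∂ (High R))) (u ℕ.* N ℕ.+ card (∂ R)) (t ℕ.* N) (card-∂-High R)) (ℚₚ.≤-reflexive (sym (bdry-affine t N u (card (∂ R)))))

    ≤-scaled-μ : (S R : Subset t n) → t ℕ.* card S ≤ card R → μ S ℚ.≤ μ R * (+ 1 / t)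
    ≤-scaled-μ S R le = ℚₚ.≤-trans (/-≤-scaled t N (card S) (card R) le)
      (ℚₚ.≤-reflexive (sym (trans (scaledʳ t N 1 (card R)) (cong (λ z → + z / (t ℕ.* N)) (ℕₚ.*-identityˡ (card R))))))

    scaled-μ-≤ : (S R : Subset t n) → u ℕ.* card R ≤ t ℕ.* card S → (+ u / t) * μ R ℚ.≤ μ S
    scaled-μ-≤ S R le = ℚₚ.≤-trans (ℚₚ.≤-reflexive (scaled t N u (card R))) (scaled-≤-/ t N (card S) (u ℕ.* card R) le)

    ≤-affine-μ : (S R : Subset t n) → t ℕ.* card S ≤ N ℕ.+ u ℕ.* card R → μ S ℚ.≤ μ R * (+ u / t) + (+ 1 / t)
    ≤-affine-μ S R le = ℚₚ.≤-trans (/-≤-scaled t N (card S) (N ℕ.+ u ℕ.* card R) le) (ℚₚ.≤-reflexive (sym (size-affine t N u (card R))))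

    affine-μ-≤ : (S R : Subset t n) → u ℕ.* N ℕ.+ card R ≤ t ℕ.* card S → (+ u / t) + (+ 1 / t) * μ R ℚ.≤ μ S
    affine-μ-≤ S R le = ℚₚ.≤-trans (ℚₚ.≤-reflexive (bdry-affine t N u (card R))) (scaled-≤-/ t N (card S) (u ℕ.* N ℕ.+ card R) le)

    μ<1/t : (S : Subset t n) → t ℕ.* card S ℕ.< N → μ S ℚ.< + 1 / t
    μ<1/t S lt = /-mono-< (card S) N 1 t
      (subst₂ ℕ._<_ (ℕₚ.*-comm t (card S)) (sym (ℕₚ.*-identityˡ N)) lt)

  full empty : ∀ {n} → Subset t n
  full _ = true
  empty _ = false

  card-full : ∀ n → card (full {n}) ≡ t ^ n
  card-full n = trans (card-∑ᵛ {n = n} full) (trans (∑ᵛ-const n 1) (ℕₚ.*-identityʳ (t ^ n)))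

  1/t≤μ-full : ∀ n → + 1 / t ℚ.≤ μ (full {n}) * (+ 1 / t)
  1/t≤μ-full n = ℚₚ.≤-reflexive (begin
    + 1 / t                                ≡⟨ expanded t (N n) 1 ⟩
    + (1 ℕ.* N n) / (t ℕ.* N n)            ≡⟨ cong (λ k → + (1 ℕ.* k) / (t ℕ.* N n)) (card-full n) ⟨
    + (1 ℕ.* card (full {n})) / (t ℕ.* N n) ≡⟨ scaledʳ t (N n) 1 (card (full {n})) ⟨
    μ (full {n}) * (+ 1 / t)               ∎)
    where
    open ≡-Reasoning
    instance
      _ = N≢0 n
      _ = tN≢0 n

  card-≤-full : ∀ {n} (S : Subset t n) → card S ≤ t ^ n
  card-≤-full {n} S = ≤-trans (card-mono S full (λ _ _ → _)) (ℕₚ.≤-reflexive (card-full n))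

  card-∂-empty : ∀ n → card (∂ (empty {n})) ≤ 0
  card-∂-empty n = ≤-trans
    (card-mono {n = n} (∂ empty) empty (λ v p → proj₁ (proj₂ (∂⁻ empty v p))))
    (ℕₚ.≤-reflexive (trans (card-∑ᵛ {n = n} empty) (trans (∑ᵛ-const n 0) (ℕₚ.*-zeroʳ (t ^ n)))))

  -- One direction tests the bound on `Low R`. The other replaces S by a segment dominating the
  -- cylinder over it and drops the leading symbol.
  small : ν ʳ< (+ 1 / t) → ∀ q →
    BelowΦ t (ν ≤ʳ_) (λ x → x) q ⇔ BelowΦ t (λ r → ν ≤ʳ (r * (+ 1 / t))) (λ x → (+ u / t) * x) q
  small (p , p<1/t , ν≤p) q = mk⇔ to from
    where
    to : BelowΦ t (ν ≤ʳ_) (λ x → x) q → BelowΦ t (λ r → ν ≤ʳ (r * (+ 1 / t))) (λ x → (+ u / t) * x) q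
    to below n R ν≤ = ℚₚ.≤-trans (below (suc n) (Low R) (up-closed ν (μ-Low (suc n) R) ν≤)) (μ-∂-Low (suc n) R)

    from : BelowΦ t (λ r → ν ≤ʳ (r * (+ 1 / t))) (λ x → (+ u / t) * x) q → BelowΦ t (ν ≤ʳ_) (λ x → x) q
    from below n S ν≤ = let s , s≥ , s≤ = padded-segment S in by-segment s s≥ s≤
      where
      by-segment : (s : Seg (2 ℕ.+ n)) → t ℕ.* card S ≤ size s → bdry s ≤ t ℕ.* card (∂ S) → q ℚ.≤ μ (∂ S)
      by-segment (low s) s≥ s≤ = ℚₚ.≤-trans
        (below n ⟦ s ⟧ (up-closed ν (≤-scaled-μ (suc n) S ⟦ s ⟧ (≤-trans s≥ (card-⟦⟧ s))) ν≤))
        (scaled-μ-≤ (suc n) (∂ S) (∂ ⟦ s ⟧) (≤-trans (ℕₚ.*-monoʳ-≤ u (card-∂-⟦⟧ s)) s≤))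
      -- The boundary already contains `u` full layers, so the full set does as a competitor; it is
      -- admissible because ν ≤ p < 1/t.
      by-segment (high s) s≥ s≤ = ℚₚ.≤-trans
        (below n full (up-closed ν (ℚₚ.≤-trans (ℚₚ.<⇒≤ p<1/t) (1/t≤μ-full (suc n))) ν≤p))
        (scaled-μ-≤ (suc n) (∂ S) (∂ full) (≤-trans (ℕₚ.*-monoʳ-≤ u (card-≤-full {suc n} (∂ full))) (≤-trans (ℕₚ.m≤m+n _ (bdry s)) s≤)))

  -- As in `small`, with `High R` as the test set and `high` as the expected leading symbol.
  large : ¬ (ν ʳ< (+ 1 / t)) → ∀ q →
    BelowΦ t (ν ≤ʳ_) (λ x → x) q
      ⇔ BelowΦ t (λ r → ν ≤ʳ ((r * (+ u / t)) + (+ 1 / t))) (λ x → (+ u / t) + ((+ 1 / t) * x)) q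
  large ν≮1/t q = mk⇔ to from
    where
    to : BelowΦ t (ν ≤ʳ_) (λ x → x) q →
      BelowΦ t (λ r → ν ≤ʳ ((r * (+ u / t)) + (+ 1 / t))) (λ x → (+ u / t) + ((+ 1 / t) * x)) q
    to below n R ν≤ = ℚₚ.≤-trans (below (suc n) (High R) (up-closed ν (μ-High (suc n) R) ν≤)) (μ-∂-High (suc n) R)

    from : BelowΦ t (λ r → ν ≤ʳ ((r * (+ u / t)) + (+ 1 / t))) (λ x → (+ u / t) + ((+ 1 / t) * x)) q →
      BelowΦ t (ν ≤ʳ_) (λ x → x) q
    from below n S ν≤ = let s , s≥ , s≤ = padded-segment S in by-segment s s≥ s≤
      where
      by-segment : (s : Seg (2 ℕ.+ n)) → t ℕ.* card S ≤ size s → bdry s ≤ t ℕ.* card (∂ S) → q ℚ.≤ μ (∂ S)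
      by-segment (high s) s≥ s≤ = ℚₚ.≤-trans
        (below n ⟦ s ⟧ (up-closed ν (≤-affine-μ (suc n) S ⟦ s ⟧ (≤-trans s≥ (ℕₚ.+-monoʳ-≤ (t ^ suc n) (ℕₚ.*-monoʳ-≤ u (card-⟦⟧ s))))) ν≤))
        (affine-μ-≤ (suc n) (∂ S) (∂ ⟦ s ⟧) (≤-trans (ℕₚ.+-monoʳ-≤ (u ℕ.* t ^ suc n) (card-∂-⟦⟧ s)) s≤))
      -- If s is full, `low s` is the layer {0}×[t]^(n+1), which is also `High` of the empty set, so
      -- the empty set is the competitor. Otherwise μ S < 1/t, against the assumption on ν.
      by-segment (low s) s≥ s≤ = case t ^ suc n ℕ.≤? size s of λ where
        (yes full≤s) → ℚₚ.≤-trans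
          (below n empty (up-closed ν (≤-affine-μ (suc n) S empty (≤-trans s≥ (≤-trans (size≤ s) (ℕₚ.m≤m+n _ _)))) ν≤))
          (affine-μ-≤ (suc n) (∂ S) (∂ empty) (≤-trans
            (ℕₚ.+-mono-≤ (ℕₚ.*-monoʳ-≤ u (size-full⇒bdry-full s full≤s)) (card-∂-empty (suc n)))
            (≤-trans (ℕₚ.≤-reflexive (ℕₚ.+-identityʳ _)) s≤)))
        (no full≰s) → ⊥-elim (ν≮1/t (μ S , μ<1/t (suc n) S (ℕₚ.≤-<-trans s≥ (ℕₚ.≰⇒> full≰s)) , ν≤))

theorem2p8 : (t : ℕ) .{{_ : NonZero t}} → 3 ≤ t → (ν : ℝ) → InUnit ν →
    ((ν ʳ< (+ 1 / t)) →
    ∀ (q : ℚ) → BelowΦ t (ν ≤ʳ_) (λ x → x) q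
    ⇔ BelowΦ t (λ r → ν ≤ʳ (r * (+ 1 / t))) (λ x → (+ (t ∸ 1) / t) * x) q)
    × (¬ (ν ʳ< (+ 1 / t)) →
    ∀ (q : ℚ) → BelowΦ t (ν ≤ʳ_) (λ x → x) q
    ⇔ BelowΦ t (λ r → ν ≤ʳ ((r * (+ (t ∸ 1) / t)) + (+ 1 / t)))
    (λ x → (+ (t ∸ 1) / t) + ((+ 1 / t) * x)) q)
theorem2p8 (suc zero) (s≤s ())
-- For this form of t, `t ∸ 1` reduces to the `u` of `Segments`.
theorem2p8 (suc (suc r)) _ ν _ = small , large
  where open Recursion r ν
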